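{- For every positive integer $n$, the Tamari lattice $T_n$ is isomorphic to a sublattice of the permutation lattice $S_n$, and the embedding can be chosen to preserve the height of elements. That is, there exists an injective map $\phi : T_n \to S_n$ such that $\phi(E\vee F)=\phi(E)\vee\phi(F)$ and $\phi(E\wedge F)=\phi(E)\wedge\phi(F)$ for all $E,F\in T_n$, and such that for every $E\in T_n$ the height of $E$ in $T_n$ equals the height of $\phi(E)$ in $S_n$.
   Context: Let $\mathbf{n}=\{1,2,\dots,n\}$. Permutation lattice $S_n$: for a permutation $\sigma=\langle s_1,\dots,s_n\rangle$ of $\mathbf{n}$ (written as a list), let $I(\sigma)=\{(s_i,s_j) : i<j,\ s_i>s_j\}$ be its set of inversions. $S_n$ is the collection of all sets $I(\sigma)$, for $\sigma$ a permutation of $\mathbf{n}$, ordered by inclusion. It is known that this partially ordered set is a lattice. Tamari lattice $T_n$: a bracketing function on $\mathbf{n}$ is a function $E:\mathbf{n}\to\mathbf{n}$ such that (E1) $k\leq E(k)$ for each $1\leq k\leq n$; (E2) if $k\leq j\leq E(k)$, then $E(j)\leq E(k)$. $T_n$ is the set of all bracketing functions on $\mathbf{n}$, ordered point-wise: $E\leq F$ if and only if $E(k)\leq F(k)$ for each $1\leq k\leq n$. It is known that this partially ordered set is a lattice. The height of an element $a$ of a finite lattice is the length of a longest chain from the least element $0$ to $a$. In each lattice, $\vee$ and $\wedge$ denote join and meet. -}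

module Defs where

open import Algebra.Lattice.Bundles.Raw using (RawLattice)
import Algebra.Construct.NaturalChoice.Min as Min
open import Data.Bool.Base using (true)
open import Data.Empty using (⊥-elim)
open import Data.Fin.Base using (Fin; zero; suc; _<_; _≤_; fromℕ; fromℕ<; opposite; punchOut)
open import Data.Fin.Induction using (<-wellFounded)
open import Data.Fin.Permutation
  using (Permutation′; permutation; _⟨$⟩ʳ_; _⟨$⟩ˡ_; inverseˡ; inverseʳ; reverse; _∘ₚ_)
open import Data.Fin.Properties
  using (_≟_; _≤?_; _<?_; ≤-refl; ≤-reflexive; ≤-trans; ≤-antisym; ≤-totalOrder; <-trans;
         <-cmp; <-irrefl; <-asym; any?; all?; injective⇒≤; punchOut-injective;
         toℕ-fromℕ<; toℕ<n; opposite-prop; ≤fromℕ)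
open import Data.Fin.Subset using (Subset; _∈_; ∣_∣)
open import Data.Fin.Subset.Properties using (∈⊤; ∣⊤∣≡n; p⊂q⇒∣p∣<∣q∣)
open import Data.Nat.Base as ℕ using (ℕ; zero; suc; z≤n; s≤s)
import Data.Nat.Properties as ℕ
open import Data.Product.Base using (∃; ∃₂; _×_; _,_; proj₁; proj₂)
open import Data.Sum.Base as Sum using (_⊎_; inj₁; inj₂)
open import Data.Vec.Base using (tabulate)
open import Data.Vec.Properties using (lookup∘tabulate; []=⇒lookup; lookup⇒[]=)
open import Function.Base using (_∘_)
open import Function.Definitions using (Injective)
open import Induction.WellFounded using (Acc; acc)
open import Level using (0ℓ; _⊔_)
open import Relation.Binary.Bundles using (Poset)
open import Relation.Binary.Construct.Closure.Transitive
  using (TransClosure; [_]; _∷_; _++_)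
open import Relation.Binary.Core using (Rel)
open import Relation.Binary.Definitions as B using (Minimum; tri<; tri≈; tri>)
open import Relation.Binary.Lattice using (Lattice)
open import Relation.Binary.PropositionalEquality
  using (_≡_; _≢_; refl; sym; trans; cong; cong₂; subst; subst₂; _≗_)
import Relation.Binary.Properties.Poset as PosetProperties
open import Relation.Nullary using (Dec; yes; no; does; ¬_)
open import Relation.Nullary.Decidable using (_×-dec_; _⊎-dec_; _→-dec_; ¬?; map′; dec-true)
open import Relation.Unary as U using (Pred; _⊆′_; _≐′_)

module _ {c ℓ₁ ℓ₂} (P : Poset c ℓ₁ ℓ₂) where

  open Poset P renaming (_≤_ to _⊑_)
  open PosetProperties P using () renaming (_<_ to _⊏_)

  -- Chain x y k : a chain x = x₀ ⊏ x₁ ⊏ … ⊏ xₖ = y, of length k.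
  data Chain : Carrier → Carrier → ℕ → Set (c ⊔ ℓ₁ ⊔ ℓ₂) where
    stop : ∀ {x y} → x ≈ y → Chain x y 0
    step : ∀ {x y z k} → x ⊏ y → Chain y z k → Chain x z (suc k)

  record HasHeight (x : Carrier) (h : ℕ) : Set (c ⊔ ℓ₁ ⊔ ℓ₂) where
    field
      least   : Carrier
      minimum : Minimum _⊑_ least
      chain   : Chain least x h
      longest : ∀ {k} → Chain least x k → k ℕ.≤ h

rawLattice : ∀ {c ℓ₁ ℓ₂} → Lattice c ℓ₁ ℓ₂ → RawLattice c ℓ₁
rawLattice L = record { _≈_ = _≈_ ; _∧_ = _∧_ ; _∨_ = _∨_ }
  where open Lattice L

-- Fin n stands for {1, …, n}, shifted to start at 0.
record Bracketing (n : ℕ) : Set where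
  field
    fun : Fin n → Fin n
    E1  : ∀ k → k ≤ fun k
    E2  : ∀ {k j} → k ≤ j → j ≤ fun k → fun j ≤ fun k

open Bracketing public

least-witness : ∀ {n} {P : Pred (Fin n) 0ℓ} → U.Decidable P → ∃ P →
                ∃ λ m → P m × (∀ j → P j → m ≤ j)
least-witness {suc n} {P} P? (w , Pw) with P? zero
... | yes P0 = zero , P0 , λ _ _ → z≤n
... | no ¬P0 with w
...   | zero   = ⊥-elim (¬P0 Pw)
...   | suc w′ with least-witness (P? ∘ suc) (w′ , Pw)
...     | m , Pm , least = suc m , Pm , λ where
            zero    P0 → ⊥-elim (¬P0 P0)
            (suc j) Pj → s≤s (least j Pj)

module _ {n : ℕ} where

  infix 4 _≈ᵀ_ _≤ᵀ_

  _≈ᵀ_ _≤ᵀ_ : Rel (Bracketing n) 0ℓ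
  E ≈ᵀ F = fun E ≗ fun F
  E ≤ᵀ F = ∀ k → fun E k ≤ fun F k

  private module M = Min (≤-totalOrder n)

  infixr 7 _∧ᵀ_
  _∧ᵀ_ : Bracketing n → Bracketing n → Bracketing n
  E ∧ᵀ F = record
    { fun = λ k → fun E k M.⊓ fun F k
    ; E1  = λ k → M.⊓-glb (E1 E k) (E1 F k)
    ; E2  = λ {k} {j} k≤j j≤ → M.⊓-glb
        (≤-trans (M.x⊓y≤x (fun E j) (fun F j))
                 (E2 E k≤j (≤-trans j≤ (M.x⊓y≤x (fun E k) (fun F k)))))
        (≤-trans (M.x⊓y≤y (fun E j) (fun F j))
                 (E2 F k≤j (≤-trans j≤ (M.x⊓y≤y (fun E k) (fun F k)))))
    }

  -- The join of E and F sends k to the least m ≥ k such that the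
  -- interval [k , m] is closed under both E and F.
  Closed : Bracketing n → Bracketing n → Fin n → Pred (Fin n) 0ℓ
  Closed E F k m = k ≤ m × (∀ j → k ≤ j → j ≤ m → fun E j ≤ m × fun F j ≤ m)

  closed? : ∀ E F k → U.Decidable (Closed E F k)
  closed? E F k m = (k ≤? m) ×-dec all? λ j →
    (k ≤? j) →-dec ((j ≤? m) →-dec ((fun E j ≤? m) ×-dec (fun F j ≤? m)))

closed-∃ : ∀ {n} (E F : Bracketing n) k → ∃ (Closed E F k)
closed-∃ {suc n} E F k = fromℕ n , ≤fromℕ k , λ j _ _ → ≤fromℕ (fun E j) , ≤fromℕ (fun F j)

module _ {n : ℕ} where

  least-closed : (E F : Bracketing n) (k : Fin n) →
                 ∃ λ m → Closed E F k m × (∀ j → Closed E F k j → m ≤ j)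
  least-closed E F k = least-witness (closed? E F k) (closed-∃ E F k)

  infixr 6 _∨ᵀ_
  _∨ᵀ_ : Bracketing n → Bracketing n → Bracketing n
  E ∨ᵀ F = record
    { fun = λ k → proj₁ (least-closed E F k)
    ; E1  = λ k → proj₁ (proj₁ (proj₂ (least-closed E F k)))
    ; E2  = λ {k} {j} k≤j j≤ →
        let m , (_ , closed) , _ = least-closed E F k
            _ , _ , least        = least-closed E F j
        in least m (j≤ , λ i j≤i i≤m → closed i (≤-trans k≤j j≤i) i≤m)
    }

  ∨ᵀ-upper : ∀ E F k → fun E k ≤ fun (E ∨ᵀ F) k × fun F k ≤ fun (E ∨ᵀ F) k
  ∨ᵀ-upper E F k =
    let m , (k≤m , closed) , _ = least-closed E F k in closed k ≤-refl k≤m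

  ∨ᵀ-least : ∀ E F G → E ≤ᵀ G → F ≤ᵀ G → E ∨ᵀ F ≤ᵀ G
  ∨ᵀ-least E F G E≤G F≤G k =
    let _ , _ , least = least-closed E F k in
    least (fun G k) (E1 G k , λ j k≤j j≤ →
      ≤-trans (E≤G j) (E2 G k≤j j≤) , ≤-trans (F≤G j) (E2 G k≤j j≤))

T : ℕ → Lattice 0ℓ 0ℓ 0ℓ
T n = record
  { Carrier   = Bracketing n
  ; _≈_       = _≈ᵀ_
  ; _≤_       = _≤ᵀ_
  ; _∨_       = _∨ᵀ_
  ; _∧_       = _∧ᵀ_
  ; isLattice = record
    { isPartialOrder = record
      { isPreorder = record
        { isEquivalence = record
          { refl  = λ _ → refl
          ; sym   = λ E≈F k → sym (E≈F k)
          ; trans = λ E≈F F≈G k → trans (E≈F k) (F≈G k)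
          }
        ; reflexive = λ E≈F k → ≤-reflexive (E≈F k)
        ; trans     = λ E≤F F≤G k → ≤-trans (E≤F k) (F≤G k)
        }
      ; antisym = λ E≤F F≤E k → ≤-antisym (E≤F k) (F≤E k)
      }
    ; supremum = λ E F →
          (λ k → proj₁ (∨ᵀ-upper E F k))
        , (λ k → proj₂ (∨ᵀ-upper E F k))
        , ∨ᵀ-least E F
    ; infimum = λ E F →
          (λ k → M.x⊓y≤x (fun E k) (fun F k))
        , (λ k → M.x⊓y≤y (fun E k) (fun F k))
        , λ G G≤E G≤F k → M.⊓-glb (G≤E k) (G≤F k)
    }
  }
  where module M = Min (≤-totalOrder n)

-- A permutation σ is the list ⟨ σ ⟨$⟩ʳ 0 , σ ⟨$⟩ʳ 1 , … ⟩, so inversions are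
-- pairs of values rather than of positions.
I : ∀ {n} → Permutation′ n → Pred (Fin n × Fin n) 0ℓ
I σ p = ∃₂ λ i j → i < j × σ ⟨$⟩ʳ j < σ ⟨$⟩ʳ i × p ≡ (σ ⟨$⟩ʳ i , σ ⟨$⟩ʳ j)

module _ {n : ℕ} (σ : Permutation′ n) where

  I-intro : ∀ {a b} → b < a → σ ⟨$⟩ˡ a < σ ⟨$⟩ˡ b → I σ (a , b)
  I-intro {a} {b} b<a p<q =
    σ ⟨$⟩ˡ a , σ ⟨$⟩ˡ b , p<q ,
    subst₂ _<_ (sym (inverseʳ σ)) (sym (inverseʳ σ)) b<a ,
    cong₂ _,_ (sym (inverseʳ σ)) (sym (inverseʳ σ))

  I-elim : ∀ {a b} → I σ (a , b) → b < a × σ ⟨$⟩ˡ a < σ ⟨$⟩ˡ b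
  I-elim (_ , _ , i<j , sj<si , refl) =
    sj<si , subst₂ _<_ (sym (inverseˡ σ)) (sym (inverseˡ σ)) i<j

  I? : ∀ a b → Dec (I σ (a , b))
  I? a b = map′ (λ (b<a , p<q) → I-intro b<a p<q) I-elim
                ((b <? a) ×-dec (σ ⟨$⟩ˡ a <? σ ⟨$⟩ˡ b))

  I-trans : ∀ {a b c} → I σ (a , b) → I σ (b , c) → I σ (a , c)
  I-trans ab bc =
    let b<a , p<q = I-elim ab
        c<b , q<r = I-elim bc
    in I-intro (<-trans c<b b<a) (<-trans p<q q<r)

  ⟨$⟩ˡ-injective : ∀ {a b} → σ ⟨$⟩ˡ a ≡ σ ⟨$⟩ˡ b → a ≡ b
  ⟨$⟩ˡ-injective eq = trans (sym (inverseʳ σ)) (trans (cong (σ ⟨$⟩ʳ_) eq) (inverseʳ σ))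

  I-cotrans : ∀ {a b c} → I σ (a , c) → c < b → b < a → I σ (a , b) ⊎ I σ (b , c)
  I-cotrans {a} {b} {c} ac c<b b<a with I-elim ac | <-cmp (σ ⟨$⟩ˡ a) (σ ⟨$⟩ˡ b)
  ... | _ , p<r | tri< p<q _ _ = inj₁ (I-intro b<a p<q)
  ... | _ , p<r | tri≈ _ p≡q _ = ⊥-elim (<-irrefl (sym (⟨$⟩ˡ-injective p≡q)) b<a)
  ... | _ , p<r | tri> _ _ q<p = inj₂ (I-intro c<b (<-trans q<p p<r))

injective⇒surjective : ∀ {n} (f : Fin n → Fin n) → Injective _≡_ _≡_ f →
                       ∀ y → ∃ λ x → f x ≡ y
injective⇒surjective {suc n} f inj y with any? (λ x → f x ≟ y)
... | yes hit  = hit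
... | no ¬hit = ⊥-elim (ℕ.1+n≰n (injective⇒≤ {f = g} (λ eq → inj (punchOut-injective (y≢ _) (y≢ _) eq))))
  where
  y≢ : ∀ x → y ≢ f x
  y≢ x eq = ¬hit (x , sym eq)
  g : Fin (suc n) → Fin n
  g x = punchOut (y≢ x)

opposite-anti : ∀ {n} {i j : Fin n} → i < j → opposite j < opposite i
opposite-anti {n} {i} {j} i<j =
  subst₂ ℕ._<_ (sym (opposite-prop j)) (sym (opposite-prop i))
    (ℕ.∸-monoʳ-< (s≤s i<j) (toℕ<n j))

-- A decidable transitive and cotransitive set of pairs a > b is the
-- inversion set of a permutation.
module FromInversions
  {n : ℕ} (C : Rel (Fin n) 0ℓ) (C? : B.Decidable C)
  (C⇒> : ∀ {a b} → C a b → b < a)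
  (C-trans : ∀ {a b c} → C a b → C b c → C a c)
  (C-cotrans : ∀ {a b c} → C a c → c < b → b < a → C a b ⊎ C b c)
  where

  infix 4 _≺_ _≺?_

  _≺_ : Rel (Fin n) 0ℓ
  a ≺ b = (a < b × ¬ C b a) ⊎ C a b

  _≺?_ : B.Decidable _≺_
  a ≺? b = ((a <? b) ×-dec ¬? (C? b a)) ⊎-dec C? a b

  ≺-irrefl : ∀ {a} → ¬ a ≺ a
  ≺-irrefl (inj₁ (a<a , _)) = <-irrefl refl a<a
  ≺-irrefl (inj₂ aa)        = <-irrefl refl (C⇒> aa)

  ≺-trans : ∀ {a b c} → a ≺ b → b ≺ c → a ≺ c
  ≺-trans (inj₂ ab) (inj₂ bc) = inj₂ (C-trans ab bc)
  ≺-trans (inj₁ (a<b , ¬ba)) (inj₁ (b<c , ¬cb)) =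
    inj₁ (<-trans a<b b<c , λ ca → Sum.[ ¬cb , ¬ba ] (C-cotrans ca a<b b<c))
  ≺-trans {a} {b} {c} (inj₁ (a<b , ¬ba)) (inj₂ bc) with <-cmp a c
  ... | tri< a<c _ _  = inj₁ (a<c , λ ca → ¬ba (C-trans bc ca))
  ... | tri≈ _ refl _ = ⊥-elim (¬ba bc)
  ... | tri> _ _ c<a  = Sum.[ ⊥-elim ∘ ¬ba , inj₂ ] (C-cotrans bc c<a a<b)
  ≺-trans {a} {b} {c} (inj₂ ab) (inj₁ (b<c , ¬cb)) with <-cmp a c
  ... | tri< a<c _ _  = inj₁ (a<c , λ ca → ¬cb (C-trans ca ab))
  ... | tri≈ _ refl _ = ⊥-elim (¬cb ab)
  ... | tri> _ _ c<a  = Sum.[ inj₂ , ⊥-elim ∘ ¬cb ] (C-cotrans ab b<c c<a)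

  ≺-connex : ∀ {a b} → a ≢ b → a ≺ b ⊎ b ≺ a
  ≺-connex {a} {b} a≢b with <-cmp a b
  ... | tri≈ _ a≡b _ = ⊥-elim (a≢b a≡b)
  ... | tri< a<b _ _ with C? b a
  ...   | yes ba = inj₂ (inj₂ ba)
  ...   | no ¬ba = inj₁ (inj₁ (a<b , ¬ba))
  ≺-connex {a} {b} a≢b | tri> _ _ b<a with C? a b
  ...   | yes ab = inj₁ (inj₂ ab)
  ...   | no ¬ab = inj₂ (inj₁ (b<a , ¬ab))

  below : Fin n → Subset n
  below a = tabulate λ x → does (x ≺? a)

  ∈below⁺ : ∀ {x a} → x ≺ a → x ∈ below a
  ∈below⁺ {x} {a} x≺a =
    lookup⇒[]= x (below a) (trans (lookup∘tabulate _ x) (dec-true (x ≺? a) x≺a))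

  ∈below⁻ : ∀ {x a} → x ∈ below a → x ≺ a
  ∈below⁻ {x} {a} x∈ =
    does⇒ (x ≺? a) (trans (sym (lookup∘tabulate _ x)) ([]=⇒lookup x∈))
    where
    does⇒ : ∀ {P : Set} (P? : Dec P) → does P? ≡ true → P
    does⇒ (yes p) _ = p

  -- The position of a is the number of values preceding it.
  rank-bound : ∀ a → ∣ below a ∣ ℕ.< n
  rank-bound a = subst (∣ below a ∣ ℕ.<_) (∣⊤∣≡n n)
    (p⊂q⇒∣p∣<∣q∣ ((λ _ → ∈⊤) , a , ∈⊤ , ≺-irrefl ∘ ∈below⁻))

  rank : Fin n → Fin n
  rank a = fromℕ< (rank-bound a)

  rank-mono : ∀ {a b} → a ≺ b → rank a < rank b
  rank-mono {a} {b} a≺b =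
    subst₂ ℕ._<_ (sym (toℕ-fromℕ< (rank-bound a))) (sym (toℕ-fromℕ< (rank-bound b)))
      (p⊂q⇒∣p∣<∣q∣ ( (λ x∈ → ∈below⁺ (≺-trans (∈below⁻ x∈) a≺b))
                   , a , ∈below⁺ a≺b , ≺-irrefl ∘ ∈below⁻))

  rank-injective : Injective _≡_ _≡_ rank
  rank-injective {a} {b} eq with a ≟ b
  ... | yes a≡b = a≡b
  ... | no a≢b with ≺-connex a≢b
  ...   | inj₁ a≺b = ⊥-elim (<-irrefl eq (rank-mono a≺b))
  ...   | inj₂ b≺a = ⊥-elim (<-irrefl (sym eq) (rank-mono b≺a))

  rank-cancel : ∀ {a b} → rank a < rank b → a ≺ b
  rank-cancel {a} {b} lt with a ≟ b
  ... | yes refl = ⊥-elim (<-irrefl refl lt)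
  ... | no a≢b with ≺-connex a≢b
  ...   | inj₁ a≺b = a≺b
  ...   | inj₂ b≺a = ⊥-elim (<-asym lt (rank-mono b≺a))

  unrank : ∀ i → ∃ λ a → rank a ≡ i
  unrank = injective⇒surjective rank rank-injective

  perm : Permutation′ n
  perm = permutation (proj₁ ∘ unrank) rank
    (λ a → rank-injective (proj₂ (unrank (rank a))))
    (λ i → proj₂ (unrank i))

  I-perm⁺ : ∀ {a b} → C a b → I perm (a , b)
  I-perm⁺ ab = I-intro perm (C⇒> ab) (rank-mono (inj₂ ab))

  I-perm⁻ : ∀ {a b} → I perm (a , b) → C a b
  I-perm⁻ ab with I-elim perm ab
  ... | b<a , lt with rank-cancel lt
  ...   | inj₁ (a<b , _) = ⊥-elim (<-asym b<a a<b)
  ...   | inj₂ ab′       = ab′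

module _ {n : ℕ} where

  infix 4 _≈ˢ_ _≤ˢ_

  -- A permutation σ represents the element I σ of Sₙ, so that equality
  -- of elements is equality of inversion sets.
  _≈ˢ_ _≤ˢ_ : Rel (Permutation′ n) 0ℓ
  σ ≈ˢ τ = I σ ≐′ I τ
  σ ≤ˢ τ = I σ ⊆′ I τ

  -- The inversion set of σ ∨ τ is the transitive closure of I σ ∪ I τ.
  module Join (σ τ : Permutation′ n) where

    A : Rel (Fin n) 0ℓ
    A a b = I σ (a , b) ⊎ I τ (a , b)

    A? : B.Decidable A
    A? a b = I? σ a b ⊎-dec I? τ a b

    A⇒> : ∀ {a b} → A a b → b < a
    A⇒> = Sum.[ proj₁ ∘ I-elim σ , proj₁ ∘ I-elim τ ]

    A-cotrans : ∀ {a b c} → A a c → c < b → b < a → A a b ⊎ A b c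
    A-cotrans (inj₁ ac) c<b b<a = Sum.map inj₁ inj₁ (I-cotrans σ ac c<b b<a)
    A-cotrans (inj₂ ac) c<b b<a = Sum.map inj₂ inj₂ (I-cotrans τ ac c<b b<a)

    C : Rel (Fin n) 0ℓ
    C = TransClosure A

    C⇒> : ∀ {a b} → C a b → b < a
    C⇒> [ ab ]    = A⇒> ab
    C⇒> (ab ∷ bc) = <-trans (C⇒> bc) (A⇒> ab)

    C-cotrans : ∀ {a b c} → C a c → c < b → b < a → C a b ⊎ C b c
    C-cotrans [ ac ] c<b b<a = Sum.map [_] [_] (A-cotrans ac c<b b<a)
    C-cotrans {b = b} (_∷_ {y = d} ad dc) c<b b<a with <-cmp b d
    ... | tri< b<d _ _  = Sum.map₁ (ad ∷_) (C-cotrans dc c<b b<d)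
    ... | tri≈ _ refl _ = inj₁ [ ad ]
    ... | tri> _ _ d<b  = Sum.map [_] (_∷ dc) (A-cotrans ad d<b b<a)

    C?′ : ∀ {a} → Acc _<_ a → ∀ b → Dec (C a b)
    C?′ {a} (acc rs) b = map′
      Sum.[ [_] , (λ (_ , ad , db) → ad ∷ db) ]
      (λ where [ ab ]    → inj₁ ab
               (ad ∷ db) → inj₂ (_ , ad , db))
      (A? a b ⊎-dec any? via)
      where
      via : ∀ d → Dec (A a d × C d b)
      via d with A? a d
      ... | no ¬ad = no (¬ad ∘ proj₁)
      ... | yes ad = map′ (ad ,_) proj₂ (C?′ (rs (A⇒> ad)) b)

    C? : B.Decidable C
    C? a = C?′ (<-wellFounded a)

    open FromInversions C C? C⇒> _++_ C-cotrans public

  infixr 6 _∨ˢ_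
  _∨ˢ_ : Permutation′ n → Permutation′ n → Permutation′ n
  σ ∨ˢ τ = Join.perm σ τ

  ∨ˢ-upperˡ : ∀ σ τ → σ ≤ˢ σ ∨ˢ τ
  ∨ˢ-upperˡ σ τ _ ab = Join.I-perm⁺ σ τ [ inj₁ ab ]

  ∨ˢ-upperʳ : ∀ σ τ → τ ≤ˢ σ ∨ˢ τ
  ∨ˢ-upperʳ σ τ _ ab = Join.I-perm⁺ σ τ [ inj₂ ab ]

  ∨ˢ-least : ∀ σ τ ρ → σ ≤ˢ ρ → τ ≤ˢ ρ → σ ∨ˢ τ ≤ˢ ρ
  ∨ˢ-least σ τ ρ σ≤ρ τ≤ρ _ ab = closure (Join.I-perm⁻ σ τ ab)
    where
    closure : ∀ {a b} → Join.C σ τ a b → I ρ (a , b)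
    closure [ ab ]    = Sum.[ σ≤ρ _ , τ≤ρ _ ] ab
    closure (ab ∷ bc) = I-trans ρ (Sum.[ σ≤ρ _ , τ≤ρ _ ] ab) (closure bc)

  -- Reversing the list of a permutation complements its inversion set,
  -- which turns joins into meets.
  rev : Permutation′ n → Permutation′ n
  rev σ = reverse ∘ₚ σ

  infixr 7 _∧ˢ_
  _∧ˢ_ : Permutation′ n → Permutation′ n → Permutation′ n
  σ ∧ˢ τ = rev (rev σ ∨ˢ rev τ)

  rev⁺ : ∀ σ {a b} → b < a → ¬ I σ (a , b) → I (rev σ) (a , b)
  rev⁺ σ {a} {b} b<a ¬ab with <-cmp (σ ⟨$⟩ˡ a) (σ ⟨$⟩ˡ b)
  ... | tri< p<q _ _ = ⊥-elim (¬ab (I-intro σ b<a p<q))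
  ... | tri≈ _ p≡q _ = ⊥-elim (<-irrefl (sym (⟨$⟩ˡ-injective σ p≡q)) b<a)
  ... | tri> _ _ q<p = I-intro (rev σ) b<a (opposite-anti q<p)

  rev⁻ : ∀ σ {a b} → I (rev σ) (a , b) → ¬ I σ (a , b)
  rev⁻ σ ab ab′ =
    <-asym (proj₂ (I-elim (rev σ) ab)) (opposite-anti (proj₂ (I-elim σ ab′)))

  I-stable : ∀ σ {a b} → b < a → ¬ I (rev σ) (a , b) → I σ (a , b)
  I-stable σ {a} {b} b<a ¬ab with I? σ a b
  ... | yes ab  = ab
  ... | no ¬ab′ = ⊥-elim (¬ab (rev⁺ σ b<a ¬ab′))

  rev-flipʳ : ∀ σ τ → rev σ ≤ˢ τ → rev τ ≤ˢ σ
  rev-flipʳ σ τ le _ ab =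
    I-stable σ (proj₁ (I-elim (rev τ) ab)) (λ ab′ → rev⁻ τ ab (le _ ab′))

  rev-flipˡ : ∀ σ τ → σ ≤ˢ rev τ → τ ≤ˢ rev σ
  rev-flipˡ σ τ le _ ab =
    rev⁺ σ (proj₁ (I-elim τ ab)) (λ ab′ → rev⁻ τ (le _ ab′) ab)

  rev-anti : ∀ σ τ → σ ≤ˢ τ → rev τ ≤ˢ rev σ
  rev-anti σ τ le _ ab =
    rev⁺ σ (proj₁ (I-elim (rev τ) ab)) (λ ab′ → rev⁻ τ ab (le _ ab′))

S : ℕ → Lattice 0ℓ 0ℓ 0ℓ
S n = record
  { Carrier   = Permutation′ n
  ; _≈_       = _≈ˢ_
  ; _≤_       = _≤ˢ_
  ; _∨_       = _∨ˢ_
  ; _∧_       = _∧ˢ_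
  ; isLattice = record
    { isPartialOrder = record
      { isPreorder = record
        { isEquivalence = record
          { refl  = (λ _ p → p) , (λ _ p → p)
          ; sym   = λ (le , ge) → ge , le
          ; trans = λ (le₁ , ge₁) (le₂ , ge₂) →
              (λ p → le₂ p ∘ le₁ p) , (λ p → ge₁ p ∘ ge₂ p)
          }
        ; reflexive = proj₁
        ; trans     = λ le₁ le₂ p → le₂ p ∘ le₁ p
        }
      ; antisym = _,_
      }
    ; supremum = λ σ τ → ∨ˢ-upperˡ σ τ , ∨ˢ-upperʳ σ τ , ∨ˢ-least σ τ
    ; infimum = λ σ τ →
          rev-flipʳ σ (rev σ ∨ˢ rev τ) (∨ˢ-upperˡ (rev σ) (rev τ))
        , rev-flipʳ τ (rev σ ∨ˢ rev τ) (∨ˢ-upperʳ (rev σ) (rev τ))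
        , λ ρ ρ≤σ ρ≤τ → rev-flipˡ (rev σ ∨ˢ rev τ) ρ
            (∨ˢ-least (rev σ) (rev τ) (rev ρ) (rev-anti ρ σ ρ≤σ) (rev-anti ρ τ ρ≤τ))
    }
  }

{-# OPTIONS --safe #-}
-- The pairs (a , b) with b < a ≤ E b form an inversion set, and E ↦ φ E, the
-- permutation with these inversions, embeds the Tamari lattice.  Meets
-- correspond to intersections.  For joins, let b < a ≤ (E ∨ F) b.  By
-- minimality [b , a - 1] is not closed under E and F, so some j in it has
-- a ≤ E j or a ≤ F j; then (a , j) is an inversion of φ E or φ F, and one
-- continues from j down to b.  Both heights equal the number of inversions of
-- φ E: a chain in T n maps to a chain in S n, along which the inversions
-- increase in number, and lowering E by one at the greatest k with k < E k
-- removes exactly one inversion.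
module Submission where

open import Defs
import Algebra.Construct.NaturalChoice.Min as Min
open import Algebra.Lattice.Morphism.Structures using (IsLatticeMonomorphism)
open import Data.Empty using (⊥-elim)
open import Data.Fin.Base using (Fin; zero; suc; _<_; _≤_; _>_; toℕ; inject₁; combine; remQuot)
open import Data.Fin.Induction using (<-wellFounded; >-wellFounded)
open import Data.Fin.Permutation using (Permutation′)
open import Data.Fin.Properties
  using (_≟_; _≤?_; _<?_; ≤-refl; ≤-reflexive; ≤-trans; ≤-antisym; ≤-totalOrder; <-trans;
         <-irrefl; ≤∧≢⇒<; any?; toℕ-inject₁; remQuot-combine; combine-remQuot)
open import Data.Fin.Subset using (Subset; _∈_; _⊆_; ⊥; ∣_∣; inside; outside)
open import Data.Fin.Subset.Properties
  using (_∈?_; ∣⊥∣≡0; p⊂q⇒∣p∣<∣q∣; p⊆q⇒∣p∣≤∣q∣; drop-there)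
open import Data.Nat.Base as ℕ using (ℕ; NonZero; zero; suc; s≤s)
import Data.Nat.Induction as ℕ using (<-wellFounded)
import Data.Nat.Properties as ℕ
open import Data.Product.Base using (∃; _×_; _,_; proj₁; proj₂; uncurry)
open import Data.Sum.Base using (_⊎_; inj₁; inj₂)
open import Data.Vec.Base using (tabulate; _∷_; here; there)
open import Data.Vec.Properties using (lookup∘tabulate; []=⇒lookup; lookup⇒[]=)
open import Function.Base using (_∘_)
open import Induction.WellFounded using (Acc; acc)
open import Level using (0ℓ)
open import Relation.Binary.Bundles using (Poset)
open import Relation.Binary.Construct.Closure.Transitive using ([_]; _∷_)
open import Relation.Binary.Core using (Rel)
open import Relation.Binary.Definitions as B using (Minimum)
open import Relation.Binary.Lattice using (module Lattice)
open import Relation.Binary.PropositionalEquality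
  using (_≡_; _≢_; refl; sym; trans; cong; subst)
import Relation.Binary.Properties.Poset as PosetProperties
open import Relation.Nullary using (Dec; yes; no; does; proof; ¬_; invert; Reflects)
open import Relation.Nullary.Decidable using (_×-dec_; ¬?; dec-true)
open import Relation.Unary as U using (Pred)

-- Cardinalities of finite subsets and extremal elements of `Fin n`

module _ {m : ℕ} {P : Pred (Fin m) 0ℓ} (P? : U.Decidable P) where

  subset : Subset m
  subset = tabulate (does ∘ P?)

  ∈-subset⁺ : ∀ {x} → P x → x ∈ subset
  ∈-subset⁺ {x} Px =
    lookup⇒[]= x subset (trans (lookup∘tabulate _ x) (dec-true (P? x) Px))

  ∈-subset⁻ : ∀ {x} → x ∈ subset → P x
  ∈-subset⁻ {x} x∈ = invert (subst (Reflects (P x))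
    (trans (sym (lookup∘tabulate _ x)) ([]=⇒lookup x∈)) (proof (P? x)))

-- Bounds the loss when a single element is exempt from inclusion; this limits how many inversions
-- one lowering step removes. At `x` itself the tails are nested, elsewhere the exception passes to
-- the tails.
p⊆q∪⁅x⁆⇒∣p∣≤1+∣q∣ : ∀ {m} (p q : Subset m) (x : Fin m) →
                     (∀ {y} → y ∈ p → y ≢ x → y ∈ q) → ∣ p ∣ ℕ.≤ suc ∣ q ∣
p⊆q∪⁅x⁆⇒∣p∣≤1+∣q∣ (s ∷ p) (t ∷ q) zero p⊆q = heads s t
  where
  tails : ∣ p ∣ ℕ.≤ ∣ q ∣
  tails = p⊆q⇒∣p∣≤∣q∣ λ y∈p → drop-there (p⊆q (there y∈p) λ ())
  heads : ∀ s t → ∣ s ∷ p ∣ ℕ.≤ suc ∣ t ∷ q ∣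
  heads inside  inside  = s≤s (ℕ.m≤n⇒m≤1+n tails)
  heads inside  outside = s≤s tails
  heads outside inside  = ℕ.m≤n⇒m≤1+n (ℕ.m≤n⇒m≤1+n tails)
  heads outside outside = ℕ.m≤n⇒m≤1+n tails
p⊆q∪⁅x⁆⇒∣p∣≤1+∣q∣ (s ∷ p) (t ∷ q) (suc x) p⊆q = heads s t (λ where refl → p⊆q here λ ())
  where
  tails : ∣ p ∣ ℕ.≤ suc ∣ q ∣
  tails = p⊆q∪⁅x⁆⇒∣p∣≤1+∣q∣ p q x λ y∈p y≢x →
    drop-there (p⊆q (there y∈p) λ where refl → y≢x refl)
  heads : ∀ s t → (s ≡ inside → zero ∈ t ∷ q) → ∣ s ∷ p ∣ ℕ.≤ suc ∣ t ∷ q ∣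
  heads inside  inside  _  = s≤s tails
  heads inside  outside ∈q with () ← ∈q refl
  heads outside inside  _  = ℕ.m≤n⇒m≤1+n tails
  heads outside outside _  = tails

predecessor : ∀ {n} {a b : Fin n} → b < a →
              ∃ λ (q : Fin n) → q < a × (∀ (x : Fin n) → x < a → x ≤ q)
predecessor {a = suc p} _ =
  inject₁ p , s≤s (ℕ.≤-reflexive (toℕ-inject₁ p)) ,
  λ x x<a → subst (toℕ x ℕ.≤_) (sym (toℕ-inject₁ p)) (ℕ.≤-pred x<a)

greatest-witness : ∀ {n} {P : Pred (Fin n) 0ℓ} → U.Decidable P → ∃ P →
                   ∃ λ k → P k × (∀ j → k < j → ¬ P j)
greatest-witness {n} {P} P? (w , Pw) = go (>-wellFounded w) Pw
  where
  go : ∀ {k} → Acc _>_ k → P k → ∃ λ k → P k × (∀ j → k < j → ¬ P j)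
  go {k} (acc rs) Pk with any? (λ j → (k <? j) ×-dec P? j)
  ... | yes (_ , k<j , Pj) = go (rs k<j) Pj
  ... | no ¬later          = k , Pk , λ j k<j Pj → ¬later (j , k<j , Pj)

-- Chains in posets

module _ {c ℓ₁ ℓ₂} (P : Poset c ℓ₁ ℓ₂) where

  open Poset P
  open PosetProperties P using (<-respˡ-≈) renaming (_<_ to _⊏_)

  -- Chains are built from the bottom, whereas the long chain below `E` is found by descending from
  -- `E`, so its steps are added at the top end.
  Chain-snoc : ∀ {x y z k} → Chain P x y k → y ⊏ z → Chain P x z (suc k)
  Chain-snoc (stop x≈y)   y⊏z = step (<-respˡ-≈ (Eq.sym x≈y) y⊏z) (stop Eq.refl)
  Chain-snoc (step x⊏w c) y⊏z = step x⊏w (Chain-snoc c y⊏z)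

Chain-map : ∀ {c ℓ₁ ℓ₂ c′ ℓ₁′ ℓ₂′} (P : Poset c ℓ₁ ℓ₂) (Q : Poset c′ ℓ₁′ ℓ₂′) →
            let module P = Poset P ; module Q = Poset Q in
            (f : P.Carrier → Q.Carrier) →
            (∀ {x y} → x P.≤ y → f x Q.≤ f y) →
            (∀ {x y} → f x Q.≈ f y → x P.≈ y) →
            ∀ {x y k} → Chain P x y k → Chain Q (f x) (f y) k
Chain-map P Q f mono inj (stop x≈y) =
  stop (Q.antisym (mono (P.reflexive x≈y)) (mono (P.reflexive (P.Eq.sym x≈y))))
  where module P = Poset P ; module Q = Poset Q
Chain-map P Q f mono inj (step (x≤y , x≉y) c) =
  step (mono x≤y , x≉y ∘ inj) (Chain-map P Q f mono inj c)

module _ {n : ℕ} where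

  private module M = Min (≤-totalOrder n)

  -- Counting inversions

  inversion? : ∀ σ → U.Decidable (I σ ∘ remQuot {n} n)
  inversion? σ x = uncurry (I? σ) (remQuot {n} n x)

  -- Pairs are coded as numbers below `n * n`, so that inversion sets have a cardinality.
  inversions : Permutation′ n → Subset (n ℕ.* n)
  inversions σ = subset (inversion? σ)

  inversions-mono : ∀ {σ τ} → σ ≤ˢ τ → inversions σ ⊆ inversions τ
  inversions-mono {σ} {τ} σ≤τ x∈ =
    ∈-subset⁺ (inversion? τ) (σ≤τ _ (∈-subset⁻ (inversion? σ) x∈))

  -- Being unequal is only a negation, so an inversion of `τ` missing from `σ` is found by searching
  -- all codes; if the search fails, `τ ≤ˢ σ`.
  ∣inversions∣-mono-< : ∀ {σ τ} → σ ≤ˢ τ → ¬ σ ≈ˢ τ →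
                        ∣ inversions σ ∣ ℕ.< ∣ inversions τ ∣
  ∣inversions∣-mono-< {σ} {τ} σ≤τ σ≉τ
    with any? (λ x → (x ∈? inversions τ) ×-dec ¬? (x ∈? inversions σ))
  ... | yes (x , x∈ , x∉) =
    p⊂q⇒∣p∣<∣q∣ (inversions-mono {σ} {τ} σ≤τ , x , x∈ , x∉)
  ... | no none = ⊥-elim (σ≉τ (σ≤τ , τ≤σ))
    where
    τ≤σ : τ ≤ˢ σ
    τ≤σ (a , b) ab with I? σ a b
    ... | yes ab′ = ab′
    ... | no ¬ab  = ⊥-elim (none
      ( combine a b
      , ∈-subset⁺ (inversion? τ) (subst (I τ) (sym (remQuot-combine a b)) ab)
      , λ ∈σ → ¬ab (subst (I σ) (remQuot-combine a b) (∈-subset⁻ (inversion? σ) ∈σ))))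

  -- Each strict step gains at least one inversion.
  Chain-bound : ∀ {σ τ k} → Chain (Lattice.poset (S n)) σ τ k →
                k ℕ.+ ∣ inversions σ ∣ ℕ.≤ ∣ inversions τ ∣
  Chain-bound {σ} {τ} (stop (σ≤τ , _)) = p⊆q⇒∣p∣≤∣q∣ (inversions-mono {σ} {τ} σ≤τ)
  Chain-bound {σ} (step {y = ρ} {k = k} (σ≤ρ , σ≉ρ) c) = ℕ.≤-trans
    (subst (ℕ._≤ k ℕ.+ ∣ inversions ρ ∣) (ℕ.+-suc k _)
      (ℕ.+-monoʳ-≤ k (∣inversions∣-mono-< {σ} {ρ} σ≤ρ σ≉ρ)))
    (Chain-bound c)

  -- The order embedding

  Inv : Bracketing n → Rel (Fin n) 0ℓ
  Inv E a b = b < a × a ≤ fun E b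

  Inv? : ∀ E → B.Decidable (Inv E)
  Inv? E a b = (b <? a) ×-dec (a ≤? fun E b)

  Inv-trans : ∀ E {a b c} → Inv E a b → Inv E b c → Inv E a c
  Inv-trans E (b<a , a≤Eb) (c<b , b≤Ec) =
    <-trans c<b b<a , ≤-trans a≤Eb (E2 E (ℕ.<⇒≤ c<b) b≤Ec)

  -- The second alternative always holds, since `b < a ≤ fun E c`.
  Inv-cotrans : ∀ E {a b c} → Inv E a c → c < b → b < a → Inv E a b ⊎ Inv E b c
  Inv-cotrans E (_ , a≤Ec) c<b b<a = inj₂ (c<b , ≤-trans (ℕ.<⇒≤ b<a) a≤Ec)

  module Φ (E : Bracketing n) =
    FromInversions (Inv E) (Inv? E) proj₁ (Inv-trans E) (Inv-cotrans E)

  φ : Bracketing n → Permutation′ n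
  φ = Φ.perm

  φ-mono : ∀ {E F} → E ≤ᵀ F → φ E ≤ˢ φ F
  φ-mono {E} {F} E≤F (a , b) ab =
    let b<a , a≤Eb = Φ.I-perm⁻ E ab in Φ.I-perm⁺ F (b<a , ≤-trans a≤Eb (E≤F b))

  -- The value of `E` at `k` is read off from the inversion `(fun E k , k)`; where `E` fixes `k`
  -- there is no such pair, and `E1` for `F` suffices.
  φ-cancel : ∀ {E F} → φ E ≤ˢ φ F → E ≤ᵀ F
  φ-cancel {E} {F} φE≤φF k with k <? fun E k
  ... | yes k<Ek = proj₂ (Φ.I-perm⁻ F (φE≤φF (fun E k , k) (Φ.I-perm⁺ E (k<Ek , ≤-refl))))
  ... | no k≮Ek  = ≤-trans (ℕ.≮⇒≥ k≮Ek) (E1 F k)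

  φ-injective : ∀ {E F} → φ E ≈ˢ φ F → E ≈ᵀ F
  φ-injective {E} {F} (le , ge) k = ≤-antisym (φ-cancel {E} {F} le k) (φ-cancel {F} {E} ge k)

  -- Preservation of meets and joins

  φ-∧ : ∀ E F → φ (E ∧ᵀ F) ≈ˢ φ E ∧ˢ φ F
  φ-∧ E F =
      S.∧-greatest {φ (E ∧ᵀ F)} {φ E} {φ F}
        (φ-mono {E ∧ᵀ F} {E} (T.x∧y≤x E F)) (φ-mono {E ∧ᵀ F} {F} (T.x∧y≤y E F))
    , λ where
        (a , b) ab →
          -- A meet in `S n` need only lie inside the intersection of the inversion sets; here that
          -- intersection is `Inv (E ∧ᵀ F)`.
          let b<a , a≤Eb = Φ.I-perm⁻ E (S.x∧y≤x (φ E) (φ F) (a , b) ab)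
              _   , a≤Fb = Φ.I-perm⁻ F (S.x∧y≤y (φ E) (φ F) (a , b) ab)
          in Φ.I-perm⁺ (E ∧ᵀ F) (b<a , M.⊓-glb a≤Eb a≤Fb)
    where
    module S = Lattice (S n)
    module T = Lattice (T n)

  ∨ᵀ-chain : ∀ E F {a} → Acc _<_ a → ∀ {b} → b < a → a ≤ fun (E ∨ᵀ F) b →
             Join.C (φ E) (φ F) a b
  ∨ᵀ-chain E F {a} (acc rs) {b} b<a a≤m
    with any? (λ j → (b ≤? j) ×-dec (j <? a) ×-dec Join.A? (φ E) (φ F) a j)
  ... | yes (j , b≤j , j<a , aj) with b ≟ j
  ...   | yes refl = [ aj ]
  -- The bound on `a` passes down to `j`, and the recursion ends because `j < a`.
  ...   | no b≢j   = aj ∷ ∨ᵀ-chain E F (rs j<a) (≤∧≢⇒< b≤j b≢j) (≤-trans (ℕ.<⇒≤ j<a) a≤m)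
  ∨ᵀ-chain E F {a} (acc rs) {b} b<a a≤m | no none =
    let q , q<a , ≤q  = predecessor b<a
        _ , _ , least = least-closed E F b
        closed : Closed E F b q
        closed = ≤q b b<a , λ j b≤j j≤q →
          let j<a = ℕ.≤-<-trans j≤q q<a in
            ≤q (fun E j) (ℕ.≰⇒> λ a≤Ej →
              none (j , b≤j , j<a , inj₁ (Φ.I-perm⁺ E (j<a , a≤Ej))))
          , ≤q (fun F j) (ℕ.≰⇒> λ a≤Fj →
              none (j , b≤j , j<a , inj₂ (Φ.I-perm⁺ F (j<a , a≤Fj))))
    -- `q < a ≤ fun (E ∨ᵀ F) b ≤ q`, the last by minimality.
    in ⊥-elim (ℕ.<⇒≱ q<a (≤-trans a≤m (least q closed)))

  φ-∨ : ∀ E F → φ (E ∨ᵀ F) ≈ˢ φ E ∨ˢ φ F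
  φ-∨ E F =
      (λ where
        (a , b) ab →
          let b<a , a≤m = Φ.I-perm⁻ (E ∨ᵀ F) ab
          in Join.I-perm⁺ (φ E) (φ F) (∨ᵀ-chain E F (<-wellFounded a) b<a a≤m))
    , ∨ˢ-least (φ E) (φ F) (φ (E ∨ᵀ F))
        (φ-mono {E} {E ∨ᵀ F} (T.x≤x∨y E F)) (φ-mono {F} {E ∨ᵀ F} (T.y≤x∨y E F))
    where module T = Lattice (T n)

  φ-isLatticeMonomorphism : IsLatticeMonomorphism (rawLattice (T n)) (rawLattice (S n)) φ
  φ-isLatticeMonomorphism = record
    { isLatticeHomomorphism = record
      { isRelHomomorphism = record
        { cong = λ {E} {F} E≈F →
              φ-mono {E} {F} (λ k → ≤-reflexive (E≈F k))
            , φ-mono {F} {E} (λ k → ≤-reflexive (sym (E≈F k)))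
        }
      ; ∧-homo = φ-∧
      ; ∨-homo = φ-∨
      }
    ; injective = λ {E} {F} → φ-injective {E} {F}
    }

  -- Preservation of heights

  0ᵀ : Bracketing n
  0ᵀ = record { fun = λ k → k ; E1 = λ _ → ≤-refl ; E2 = λ _ j≤k → j≤k }

  0ᵀ-minimum : Minimum _≤ᵀ_ 0ᵀ
  0ᵀ-minimum = E1

  φ0ᵀ-minimum : Minimum _≤ˢ_ (φ 0ᵀ)
  φ0ᵀ-minimum σ (a , b) ab =
    let b<a , a≤b = Φ.I-perm⁻ 0ᵀ ab in ⊥-elim (ℕ.<⇒≱ b<a a≤b)

  module Lower (E : Bracketing n) {k : Fin n} (k<Ek : k < fun E k)
               (fixed : ∀ j → k < j → ¬ j < fun E j) where

    q : Fin n
    q = proj₁ (predecessor k<Ek)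

    q<Ek : q < fun E k
    q<Ek = proj₁ (proj₂ (predecessor k<Ek))

    ≤q : ∀ x → x < fun E k → x ≤ q
    ≤q = proj₂ (proj₂ (predecessor k<Ek))

    -- The decision is an argument so that the proofs below can match on it directly.
    value : ∀ j → Dec (j ≡ k) → Fin n
    value j (yes _) = q
    value j (no  _) = fun E j

    value≤ : ∀ j d → value j d ≤ fun E j
    value≤ j (yes refl) = ℕ.<⇒≤ q<Ek
    value≤ j (no  _)    = ≤-refl

    E1′ : ∀ j d → j ≤ value j d
    E1′ j (yes refl) = ≤q k k<Ek
    E1′ j (no  _)    = E1 E j

    E2′ : ∀ {i j} d e → i ≤ j → j ≤ value i d → value j e ≤ value i d
    E2′         (yes refl) (yes refl) _   _    = ≤-refl
    -- The maximality of `k` enters here: `j` lies above `k`, so `E` fixes it and `fun E j ≤ j ≤ q`.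
    E2′ {j = j} (yes refl) (no j≢k)   k≤j j≤q  =
      ≤-trans (ℕ.≮⇒≥ (fixed j (≤∧≢⇒< k≤j (j≢k ∘ sym)))) j≤q
    E2′ {j = j} (no _)     e          i≤j j≤Ei = ≤-trans (value≤ j e) (E2 E i≤j j≤Ei)

    lower : Bracketing n
    lower = record
      { fun = λ j → value j (j ≟ k)
      ; E1  = λ j → E1′ j (j ≟ k)
      ; E2  = λ {i} {j} → E2′ (i ≟ k) (j ≟ k)
      }

    lower≤ : lower ≤ᵀ E
    lower≤ j = value≤ j (j ≟ k)

    lower≉ : ¬ lower ≈ᵀ E
    lower≉ eq = differ (k ≟ k) (eq k)
      where
      differ : ∀ d → value k d ≢ fun E k
      differ (yes _)   q≡Ek = <-irrefl q≡Ek q<Ek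
      differ (no k≢k)  _    = k≢k refl

    Inv-lower : ∀ {a b} → Inv E a b → (a , b) ≢ (fun E k , k) → Inv lower a b
    Inv-lower {a} {b} (b<a , a≤Eb) ≢top = b<a , bound (b ≟ k)
      where
      bound : ∀ d → a ≤ value b d
      bound (yes refl) = ≤q a (≤∧≢⇒< a≤Eb λ where refl → ≢top refl)
      bound (no _)     = a≤Eb

    ∣inversions∣-lower : ∣ inversions (φ E) ∣ ℕ.≤ suc ∣ inversions (φ lower) ∣
    ∣inversions∣-lower =
      p⊆q∪⁅x⁆⇒∣p∣≤1+∣q∣ (inversions (φ E)) (inversions (φ lower)) (combine (fun E k) k)
        λ {x} x∈ x≢ → ∈-subset⁺ (inversion? (φ lower)) (Φ.I-perm⁺ lower
          (Inv-lower (Φ.I-perm⁻ E (∈-subset⁻ (inversion? (φ E)) x∈)) λ eq →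
            x≢ (trans (sym (combine-remQuot {n} n x)) (cong (uncurry combine) eq))))

  Chain-φ : ∀ {E F k} → Chain (Lattice.poset (T n)) E F k →
            Chain (Lattice.poset (S n)) (φ E) (φ F) k
  Chain-φ = Chain-map (Lattice.poset (T n)) (Lattice.poset (S n)) φ
    (λ {E} {F} → φ-mono {E} {F}) (λ {E} {F} → φ-injective {E} {F})

  -- Recursion on the number of inversions, which each lowering strictly decreases. It drops by at
  -- most one, so the chain is at least as long as that number.
  long-chain : ∀ E → Acc ℕ._<_ ∣ inversions (φ E) ∣ →
               ∃ λ h → Chain (Lattice.poset (T n)) 0ᵀ E h × ∣ inversions (φ E) ∣ ℕ.≤ h
  long-chain E (acc rs) with any? (λ k → k <? fun E k)
  ... | no none = 0 , stop (λ k → ≤-antisym (E1 E k) (E≤ k)) ,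
    subst (∣ inversions (φ E) ∣ ℕ.≤_) (∣⊥∣≡0 (n ℕ.* n)) (p⊆q⇒∣p∣≤∣q∣ {q = ⊥} λ x∈ →
      let b<a , a≤Eb = Φ.I-perm⁻ E (∈-subset⁻ (inversion? (φ E)) x∈)
      in ⊥-elim (ℕ.<⇒≱ b<a (≤-trans a≤Eb (E≤ _))))
    where
    E≤ : ∀ k → fun E k ≤ k
    E≤ k = ℕ.≮⇒≥ λ k<Ek → none (k , k<Ek)
  ... | yes moved =
    let k , k<Ek , fixed = greatest-witness (λ k → k <? fun E k) moved
        open Lower E k<Ek fixed
        fewer = ∣inversions∣-mono-< {φ lower} {φ E} (φ-mono {lower} {E} lower≤)
                  (lower≉ ∘ φ-injective {lower} {E})
        h , c , ≤h = long-chain lower (rs fewer)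
    in suc h , Chain-snoc (Lattice.poset (T n)) c (lower≤ , lower≉) ,
       ℕ.≤-trans ∣inversions∣-lower (s≤s ≤h)

  heights : ∀ E → ∃ λ h → HasHeight (Lattice.poset (T n)) E h ×
                          HasHeight (Lattice.poset (S n)) (φ E) h
  heights E =
    let h , c , inv≤h = long-chain E (ℕ.<-wellFounded _)
        longest : ∀ {k} → Chain (Lattice.poset (S n)) (φ 0ᵀ) (φ E) k → k ℕ.≤ h
        -- `Chain-bound` adds the inversions of `φ 0ᵀ` to the length; they are dropped. Through
        -- `Chain-φ` the same bound covers chains in `T n`.
        longest c = ℕ.≤-trans (ℕ.m≤m+n _ _) (ℕ.≤-trans (Chain-bound c) inv≤h)
    in h
     , record { least = 0ᵀ ; minimum = 0ᵀ-minimum ; chain = c ; longest = longest ∘ Chain-φ }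
     , record { least = φ 0ᵀ ; minimum = φ0ᵀ-minimum ; chain = Chain-φ c ; longest = longest }

theorem1 : (n : ℕ) → .{{_ : NonZero n}} →
    ∃ λ (φ : Lattice.Carrier (T n) → Lattice.Carrier (S n)) →
    IsLatticeMonomorphism (rawLattice (T n)) (rawLattice (S n)) φ ×
    (∀ E → ∃ λ h → HasHeight (Lattice.poset (T n)) E h ×
    HasHeight (Lattice.poset (S n)) (φ E) h)
theorem1 n = φ , φ-isLatticeMonomorphism , heights
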